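{- Let $N$ be a finitary plain structural conflict net without a fully reachable pure $\mathsf{M}$. Then $N$ is distributable up to $\approx^\Delta_{bSTb}$, i.e. there exists a distributed Petri net $N'$ with $N'\approx^\Delta_{bSTb}N$.
   Context: **Petri nets.** Let $\mathrm{Act}$ be a set of visible actions, $\tau\notin\mathrm{Act}$ the invisible action, $\mathrm{Act}_\tau=\mathrm{Act}\cup\{\tau\}$. A multiset over $X$ is a function $A:X\to\mathbb N$; $\le,+,-$ are pointwise, $\cup$ is pointwise max, $\cap$ pointwise min, $x\in A$ iff $A(x)\neq 0$, $\varnothing$ is the zero multiset; $A$ is finite iff $\sum_x A(x)<\infty$. Sets are identified with $0/1$-valued multisets. A (labelled) Petri net is $N=(S,T,F,M_0,\ell)$ with $S,T$ disjoint sets (places, transitions), $F:(S\times T\cup T\times S)\to\mathbb N$, initial marking $M_0:S\to\mathbb N$, labelling $\ell:T\to\mathrm{Act}_\tau$. A marking is a multiset $M\in\mathbb N^S$. For $x\in S\cup T$ the multisets ${}^\bullet x,x^\bullet$ are ${}^\bullet x(y)=F(y,x)$, $x^\bullet(y)=F(x,y)$; they extend additively to finite multisets $G$ of transitions. For non-empty finite $G\in\mathbb N^T$, $M[G\rangle M'$ iff ${}^\bullet G\le M$ and $M'=(M-{}^\bullet G)+G^\bullet$; $M[G\rangle$ means $\exists M'.\,M[G\rangle M'$; $M[t\rangle M'$ abbreviates $M[\{t\}\rangle M'$. $[M_0\rangle$ is the set of reachable markings: the smallest set containing $M_0$ and closed under steps $[G\rangle$. $t\smile u$ iff $\exists M\in[M_0\rangle.\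 M[\{t\}+\{u\}\rangle$ (also for $t=u$). $M\xrightarrow{\alpha}M'$ iff $M[t\rangle M'$ for some $t$ with $\ell(t)=\alpha$. **Classes of nets.** $N$ is a *structural conflict net* iff $t\smile u$ implies ${}^\bullet t\cap{}^\bullet u=\varnothing$. $N$ is *plain* iff $\ell$ is injective and no transition is labelled $\tau$. $N$ is *finitary* iff ${}^\bullet t\ne\varnothing$ for all $t\in T$, and every reachable marking is finite and enables only finitely many transitions. $N$ is *distributed* iff there is a function $D$ from $S\cup T$ to some set of locations such that (1) $s\in{}^\bullet t$ implies $D(t)=D(s)$ for $s\in S,t\in T$, and (2) $t\smile u$ implies $D(t)\neq D(u)$ for $t,u\in T$. $N$ has a *fully reachable pure $\mathsf M$* iff there are $t,u,v\in T$ with ${}^\bullet t\cap{}^\bullet u\ne\varnothing$, ${}^\bullet u\cap{}^\bullet v\neq\varnothing$, ${}^\bullet t\cap{}^\bullet v=\varnothing$ and some $M\in[M_0\rangle$ with ${}^\bullet t\cup{}^\bullet u\cup{}^\bullet v\le M$. **ST-LTS.** An ST-marking of $N$ is a pair $(M,U)\in\mathbb N^S\times T^*$; the initial one is $(M_0,\varepsilon)$. Transitions: $(M,U)\xrightarrow{a^+}(M',U')$ iff there is $t$ with $\ell(t)=a$, $M[t\rangle$, $M'=M-{}^\bullet t$, $U'=Ut$; $(M,U)\xrightarrow{a^{ -n}}(M',U')$ ($a\in\mathrm{Act}$, $n>0$) iff the $n$-th element $t$ of $U$ exists and has $\ell(t)=a$, $U'$ is $U$ with the $n$-th element removed, $M'=M+t^\bullet$;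 $(M,U)\xrightarrow{\tau}(M',U')$ iff $M\xrightarrow{\tau}M'$ and $U'=U$. The ST-LTS of $N$ has the ST-markings as states. **Branching bisimilarity with explicit divergence.** For labelled transition systems (LTSs), $\Longrightarrow$ is the reflexive transitive closure of $\xrightarrow{\tau}$, and $p\xrightarrow{(\alpha)}p'$ means $p\xrightarrow{\alpha}p'$ or ($\alpha=\tau$ and $p=p'$). A branching bisimulation between two LTSs is a relation $\mathcal B$ between their states such that initial states are related; if $p\,\mathcal B\,q$ and $p\xrightarrow{\alpha}p'$ then $q\Longrightarrow q^\dagger\xrightarrow{(\alpha)}q'$ for some $q^\dagger,q'$ with $p\,\mathcal B\,q^\dagger$, $p'\,\mathcal B\,q'$; and symmetrically. The LTSs are branching bisimilar with explicit divergence iff there is such a $\mathcal B$ satisfying moreover: if $p\,\mathcal B\,q$ and $p=p_0\xrightarrow{\tau}p_1\xrightarrow{\tau}\cdots$ is infinite with $p_k\,\mathcal B\,q$ for all $k$, then there is an infinite $q=q_0\xrightarrow{\tau}q_1\xrightarrow{\tau}\cdots$ with $p_k\,\mathcal B\,q_l$ for all $k,l$; and symmetrically. (When one of the LTSs has no infinite $\tau$-sequence from a reachable state, the extra condition amounts to the other having none either.) $N_1\approx^\Delta_{bSTb}N_2$ iff the ST-LTSs of $N_1,N_2$ are branching bisimilar with explicit divergence. -}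

module Defs where

open import Data.Fin using (Fin; toℕ)
open import Data.List using (List; []; _∷_; [_]; _∷ʳ_; length; lookup; map; removeAt; sum)
open import Data.List.Membership.Propositional using () renaming (_∈_ to _∈ˡ_)
open import Data.List.Relation.Unary.Unique.Propositional using (Unique)
open import Data.Nat using (ℕ; suc; _+_; _∸_; _≤_; _⊔_; _⊓_)
open import Data.Product using (Σ-syntax; ∃-syntax; _×_; _,_)
open import Data.Sum using (_⊎_; inj₁; inj₂)
open import Function using (flip)
open import Function.Definitions using (Injective)
open import Relation.Binary.Construct.Closure.ReflexiveTransitive using (Star)
open import Relation.Binary.PropositionalEquality using (_≡_; _≢_; _≗_)
open import Relation.Nullary using (¬_)

-- Multisets are functions into ℕ, compared pointwise by _≗_ since
-- function extensionality is not available.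

Multiset : Set → Set
Multiset X = X → ℕ

module _ {X : Set} where

  infix  4 _∈ᵐ_ _≤ᵐ_
  infixl 6 _+ᵐ_ _-ᵐ_ _∪_
  infixl 7 _∩_

  ∅ : Multiset X
  ∅ _ = 0

  _∈ᵐ_ : X → Multiset X → Set
  x ∈ᵐ A = A x ≢ 0

  _≤ᵐ_ : Multiset X → Multiset X → Set
  A ≤ᵐ B = ∀ x → A x ≤ B x

  _+ᵐ_ _-ᵐ_ _∪_ _∩_ : Multiset X → Multiset X → Multiset X
  (A +ᵐ B) x = A x + B x
  (A -ᵐ B) x = A x ∸ B x
  (A ∪ B) x  = A x ⊔ B x
  (A ∩ B) x  = A x ⊓ B x

  -- Σₓ A(x) < ∞: the sum over an arbitrary index set is the supremum of
  -- the sums over its finite subsets.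
  FiniteMultiset : Multiset X → Set
  FiniteMultiset A = ∃[ n ] (∀ xs → Unique xs → sum (map A xs) ≤ n)

FiniteSubset : {X : Set} → (X → Set) → Set
FiniteSubset P = ∃[ xs ] (∀ x → P x → x ∈ˡ xs)

data WithTau (A : Set) : Set where
  τ   : WithTau A
  vis : A → WithTau A

record PetriNet (Act : Set) : Set₁ where
  field
    S T : Set
    Fˢᵗ : S → T → ℕ
    Fᵗˢ : T → S → ℕ
    M₀  : Multiset S
    ℓ   : T → WithTau Act

  Marking : Set
  Marking = Multiset S

  infix 30 •_ _•

  •_ : T → Multiset S
  • t = λ s → Fˢᵗ s t

  _• : T → Multiset S
  t • = λ s → Fᵗˢ t s

  -- A finite multiset of transitions is represented by a list, in which
  -- each transition occurs as often as its multiplicity; the order is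
  -- irrelevant.
  pre : List T → Multiset S
  pre []      = ∅
  pre (t ∷ G) = • t +ᵐ pre G

  post : List T → Multiset S
  post []      = ∅
  post (t ∷ G) = t • +ᵐ post G

  infix 4 _[_⟩_ _[_⟩ _⌣_ _-[_]→_

  _[_⟩_ : Marking → List T → Marking → Set
  M [ G ⟩ M′ = G ≢ [] × pre G ≤ᵐ M × M′ ≗ (M -ᵐ pre G) +ᵐ post G

  _[_⟩ : Marking → List T → Set
  M [ G ⟩ = ∃[ M′ ] M [ G ⟩ M′

  data Reachable : Marking → Set where
    initial : Reachable M₀
    step    : ∀ {M G M′} → Reachable M → M [ G ⟩ M′ → Reachable M′

  _⌣_ : T → T → Set
  t ⌣ u = ∃[ M ] Reachable M × M [ t ∷ u ∷ [] ⟩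

  _-[_]→_ : Marking → WithTau Act → Marking → Set
  M -[ α ]→ M′ = ∃[ t ] ℓ t ≡ α × M [ [ t ] ⟩ M′

module _ {Act : Set} (N : PetriNet Act) where
  open PetriNet N

  StructuralConflict : Set
  StructuralConflict = ∀ t u → t ⌣ u → (• t ∩ • u) ≗ ∅

  Plain : Set
  Plain = Injective _≡_ _≡_ ℓ × (∀ t → ℓ t ≢ τ)

  Finitary : Set
  Finitary = (∀ t → ¬ (• t ≗ ∅))
           × (∀ M → Reachable M →
                FiniteMultiset M × FiniteSubset (λ t → M [ [ t ] ⟩))

  Distributed : Set₁
  Distributed = Σ[ Loc ∈ Set ] Σ[ D ∈ (S ⊎ T → Loc) ]
      (∀ s t → s ∈ᵐ • t → D (inj₂ t) ≡ D (inj₁ s))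
    × (∀ t u → t ⌣ u → D (inj₂ t) ≢ D (inj₂ u))

  HasFullyReachablePureM : Set
  HasFullyReachablePureM = ∃[ t ] ∃[ u ] ∃[ v ]
      ¬ ((• t ∩ • u) ≗ ∅)
    × ¬ ((• u ∩ • v) ≗ ∅)
    × (• t ∩ • v) ≗ ∅
    × (∃[ M ] Reachable M × (• t ∪ • u ∪ • v) ≤ᵐ M)

record LTS (L : Set) : Set₁ where
  field
    State : Set
    init  : State
    Trans : State → WithTau L → State → Set

  infix 4 _⟹_

  _⟹_ : State → State → Set
  _⟹_ = Star (λ p p′ → Trans p τ p′)

  OptTrans : State → WithTau L → State → Set
  OptTrans p α p′ = Trans p α p′ ⊎ (α ≡ τ × p ≡ p′)

  InfiniteTauPath : State → (ℕ → State) → Set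
  InfiniteTauPath p π = π 0 ≡ p × (∀ k → Trans (π k) τ (π (suc k)))

module _ {L : Set} (P Q : LTS L) where
  private
    module P = LTS P
    module Q = LTS Q

  BranchingTransfer : (P.State → Q.State → Set) → Set
  BranchingTransfer B = ∀ {p q α p′} → B p q → P.Trans p α p′ →
    ∃[ q† ] ∃[ q′ ] (q Q.⟹ q†) × Q.OptTrans q† α q′ × B p q† × B p′ q′

  DivergenceTransfer : (P.State → Q.State → Set) → Set
  DivergenceTransfer B = ∀ {p q} → B p q →
    ∀ π → P.InfiniteTauPath p π → (∀ k → B (π k) q) →
    ∃[ ρ ] Q.InfiniteTauPath q ρ × (∀ k l → B (π k) (ρ l))

module _ {L : Set} (P Q : LTS L) where
  private
    module P = LTS P
    module Q = LTS Q

  BranchingBisimulation : (P.State → Q.State → Set) → Set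
  BranchingBisimulation B = B P.init Q.init
                          × BranchingTransfer P Q B
                          × BranchingTransfer Q P (flip B)

  BranchingBisimilarΔ : Set₁
  BranchingBisimilarΔ = Σ[ B ∈ (P.State → Q.State → Set) ]
      BranchingBisimulation B
    × DivergenceTransfer P Q B
    × DivergenceTransfer Q P (flip B)

infix 9 _⁺ _⁻_

-- a ⁻ n: the occurrence of a at position n, counting from 1, ends.
data STAct (Act : Set) : Set where
  _⁺  : Act → STAct Act
  _⁻_ : Act → ℕ → STAct Act

module _ {Act : Set} (N : PetriNet Act) where
  open PetriNet N

  STMarking : Set
  STMarking = Marking × List T

  STTrans : STMarking → WithTau (STAct Act) → STMarking → Set
  STTrans (M , U) (vis (a ⁺)) (M′ , U′) =
    ∃[ t ] ℓ t ≡ vis a × M [ [ t ] ⟩ × M′ ≗ M -ᵐ • t × U′ ≡ U ∷ʳ t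
  STTrans (M , U) (vis (a ⁻ n)) (M′ , U′) =
    Σ[ i ∈ Fin (length U) ] n ≡ suc (toℕ i)
      × ℓ (lookup U i) ≡ vis a
      × U′ ≡ removeAt U i
      × M′ ≗ M +ᵐ lookup U i •
  STTrans (M , U) τ (M′ , U′) = (M -[ τ ]→ M′) × U′ ≡ U

  ST-LTS : LTS (STAct Act)
  ST-LTS = record
    { State = STMarking
    ; init  = M₀ , []
    ; Trans = STTrans
    }

infix 4 _≈Δ-bSTb_

_≈Δ-bSTb_ : {Act : Set} → PetriNet Act → PetriNet Act → Set₁
N₁ ≈Δ-bSTb N₂ = BranchingBisimilarΔ (ST-LTS N₁) (ST-LTS N₂)

{-# OPTIONS --safe #-}
module Submission where

-- In a reachable marking conflict is an equivalence relation on the enabled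
-- transitions: transitivity is the absence of a fully reachable pure M. When
-- a transition t fires, its class disappears and the other classes survive;
-- a newly enabled transition joins at most one surviving class, as otherwise
-- two concurrent transitions would be in conflict by transitivity. So classes
-- never merge, and each can be given a location of its own for its lifetime.
-- The implementation runs every class as a sequential component that fires
-- one of the transitions offered to it and reports this to a controller, which
-- then updates its record of the marking by a τ-step and creates new classes and
-- offers. These τ-steps are inert: a transition offered to an idle class
-- stays offered, and each visible transition causes only one of them.

open import Defs
open import Axiom.ExcludedMiddle using (ExcludedMiddle)
open import Data.Empty using (⊥-elim)
open import Data.Fin using (Fin; zero; suc; toℕ)
open import Data.List
  using (List; []; _∷_; [_]; _++_; _∷ʳ_; length; lookup; map; removeAt)
open import Data.List.Membership.Propositional using (_∈_)
open import Data.List.Properties using (++-assoc; map-++; map-cong-local)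
open import Data.List.Relation.Binary.Permutation.Propositional
  using (_↭_; prep; swap; ↭-refl; ↭-sym; ↭-trans; ↭-reflexive)
open import Data.List.Relation.Binary.Permutation.Propositional.Properties
  using (map⁺; shift; ∈-resp-↭; ↭-length; ++⁺ˡ; ++⁺ʳ)
open import Data.List.Relation.Unary.All using (tabulate)
open import Data.List.Relation.Unary.Any using (here; there)
open import Data.List.Membership.Propositional.Properties using (∈-++⁺ˡ; ∈-∃++)
open import Data.Nat using (ℕ; zero; suc; _+_; _∸_; _⊓_; _≤_; _<_; z≤n; s≤s)
open import Data.Nat.ListAction using (sum)
open import Data.Nat.ListAction.Properties using (sum-↭)
open import Data.Nat.Properties
open import Data.Product using (Σ-syntax; ∃-syntax; _×_; _,_; proj₁; proj₂)
open import Data.Sum using (_⊎_; inj₁; inj₂)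
open import Data.Unit using (⊤; tt)
open import Level using (0ℓ)
open import Relation.Binary.Construct.Closure.ReflexiveTransitive using (ε; _◅_)
open import Relation.Binary.PropositionalEquality
  using (_≡_; _≢_; _≗_; refl; sym; trans; cong; cong₂; subst; module ≡-Reasoning)
open import Relation.Nullary using (¬_; yes; no)
open import Relation.Nullary.Decidable using (decidable-stable)

-- Permutations and positions in lists

module _ {A : Set} where

  lookup-removeAt-↭ : ∀ (xs : List A) i → lookup xs i ∷ removeAt xs i ↭ xs
  lookup-removeAt-↭ (x ∷ xs) zero    = ↭-refl
  lookup-removeAt-↭ (x ∷ xs) (suc i) =
    ↭-trans (swap _ x ↭-refl) (prep x (lookup-removeAt-↭ xs i))

  ∈⇒↭ : ∀ {x : A} {xs} → x ∈ xs → ∃[ ys ] xs ↭ x ∷ ys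
  ∈⇒↭ {x} x∈xs with ∈-∃++ x∈xs
  ... | ys , zs , refl = ys ++ zs , shift x ys zs

module _ {A B : Set} (f : A → B) where

  -- Matches the end of an action in one ST-LTS with the end at the same position in the other,
  -- where the running transitions are `map (start h) U` instead of `U`. The index types differ,
  -- hence the comparison by `toℕ`.
  unmap-index : ∀ xs (i : Fin (length (map f xs))) → ∃[ j ]
    toℕ i ≡ toℕ j × lookup (map f xs) i ≡ f (lookup xs j)
                  × removeAt (map f xs) i ≡ map f (removeAt xs j)
  unmap-index (x ∷ xs) zero = zero , refl , refl , refl
  unmap-index (x ∷ xs) (suc i) with unmap-index xs i
  ... | j , i≡j , lookup≡ , rest≡ =
    suc j , cong suc i≡j , lookup≡ , cong (f x ∷_) rest≡

  map-index : ∀ xs (j : Fin (length xs)) → Σ[ i ∈ Fin (length (map f xs)) ]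
    toℕ i ≡ toℕ j × lookup (map f xs) i ≡ f (lookup xs j)
                  × removeAt (map f xs) i ≡ map f (removeAt xs j)
  map-index (x ∷ xs) zero = zero , refl , refl , refl
  map-index (x ∷ xs) (suc j) with map-index xs j
  ... | i , i≡j , lookup≡ , rest≡ =
    suc i , cong suc i≡j , lookup≡ , cong (f x ∷_) rest≡

-- Classical indicators, search and counting

module Classical (em : ExcludedMiddle 0ℓ) where

  by-contradiction : {P : Set} → ¬ ¬ P → P
  by-contradiction = decidable-stable em

  ind : Set → ℕ
  ind P with em {P}
  ... | yes _ = 1
  ... | no _  = 0

  module _ {P : Set} where

    ind-yes : P → ind P ≡ 1
    ind-yes p with em {P}
    ... | yes _ = refl
    ... | no ¬p = ⊥-elim (¬p p)

    ind-no : ¬ P → ind P ≡ 0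
    ind-no ¬p with em {P}
    ... | yes p = ⊥-elim (¬p p)
    ... | no _  = refl

    ind-≢0 : ind P ≢ 0 → P
    ind-≢0 ≢0 = by-contradiction (λ ¬p → ≢0 (ind-no ¬p))

    ind-≤1 : ind P ≤ 1
    ind-≤1 with em {P}
    ... | yes _ = ≤-refl
    ... | no _  = z≤n

  ind-cong : {P Q : Set} → (P → Q) → (Q → P) → ind P ≡ ind Q
  ind-cong {P} f g with em {P}
  ... | yes p = sym (ind-yes (f p))
  ... | no ¬p = sym (ind-no (λ q → ¬p (g q)))

  module _ {X : Set} where

    first : (X → Set) → X → List X → X
    first P d [] = d
    first P d (x ∷ xs) with em {P x}
    ... | yes _ = x
    ... | no _  = first P d xs

    first-satisfies : ∀ (P : X → Set) {d x xs} → x ∈ xs → P x → P (first P d xs)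
    first-satisfies P {xs = y ∷ xs} x∈ px with em {P y}
    ... | yes py = py
    first-satisfies P (here refl) px  | no ¬py = ⊥-elim (¬py px)
    first-satisfies P (there x∈) px | no ¬py = first-satisfies P x∈ px

    -- The search stops at `x` at the latest, so it never falls through to the defaults `d` and `e`,
    -- which may therefore differ.
    first-cong : ∀ (P Q : X → Set) {d e x xs} → (∀ y → P y → Q y) → (∀ y → Q y → P y) →
      x ∈ xs → P x → first P d xs ≡ first Q e xs
    first-cong P Q {xs = y ∷ xs} f g x∈ px with em {P y} | em {Q y}
    ... | yes _ | yes _ = refl
    ... | yes p | no ¬q = ⊥-elim (¬q (f y p))
    ... | no ¬p | yes q = ⊥-elim (¬p (g y q))
    first-cong P Q f g (here refl) px | no ¬p | no _ = ⊥-elim (¬p px)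
    first-cong P Q f g (there x∈) px  | no _  | no _ = first-cong P Q f g x∈ px

    count : List X → Multiset X
    count xs y = sum (map (λ x → ind (y ≡ x)) xs)

    count-↭ : ∀ {xs ys} → xs ↭ ys → count xs ≗ count ys
    count-↭ p y = sum-↭ (map⁺ _ p)

    count-∈ : ∀ xs {y} → count xs y ≢ 0 → y ∈ xs
    count-∈ [] ≢0 = ⊥-elim (≢0 refl)
    count-∈ (x ∷ xs) {y} ≢0 with em {y ≡ x}
    ... | yes refl = here refl
    ... | no _     = there (count-∈ xs ≢0)

-- Firing in an arbitrary net

module NetLemmas {Act : Set} (N : PetriNet Act) where
  open PetriNet N

  pre-sum : ∀ G s → pre G s ≡ sum (map (λ t → (• t) s) G)
  pre-sum []      s = refl
  pre-sum (t ∷ G) s = cong ((• t) s +_) (pre-sum G s)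

  post-sum : ∀ G s → post G s ≡ sum (map (λ t → (t •) s) G)
  post-sum []      s = refl
  post-sum (t ∷ G) s = cong ((t •) s +_) (post-sum G s)

  pre-↭ : ∀ {G H} → G ↭ H → pre G ≗ pre H
  pre-↭ {G} {H} p s = trans (pre-sum G s) (trans (sum-↭ (map⁺ _ p)) (sym (pre-sum H s)))

  post-↭ : ∀ {G H} → G ↭ H → post G ≗ post H
  post-↭ {G} {H} p s = trans (post-sum G s) (trans (sum-↭ (map⁺ _ p)) (sym (post-sum H s)))

  ∈⇒•≤pre : ∀ {t G} → t ∈ G → • t ≤ᵐ pre G
  ∈⇒•≤pre (here refl) s = m≤m+n _ _
  ∈⇒•≤pre (there {x} t∈) s = ≤-trans (∈⇒•≤pre t∈ s) (m≤n+m _ ((• x) s))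

  fireable : ∀ {M t} → • t ≤ᵐ M → M [ [ t ] ⟩ (M -ᵐ • t) +ᵐ t •
  fireable {M} {t} le = (λ ()) , (λ s → subst (_≤ M s) (sym (+-identityʳ _)) (le s))
    , λ s → sym (cong₂ _+_ (cong (M s ∸_) (+-identityʳ ((• t) s))) (+-identityʳ ((t •) s)))

  fired : ∀ {M t M′} → M [ [ t ] ⟩ M′ → • t ≤ᵐ M × M′ ≗ (M -ᵐ • t) +ᵐ t •
  fired {M} {t} (_ , le , eq) = (λ s → subst (_≤ M s) (+-identityʳ _) (le s))
    , λ s → trans (eq s)
        (cong₂ _+_ (cong (M s ∸_) (+-identityʳ ((• t) s))) (+-identityʳ ((t •) s)))

  enabled : ∀ {M t} → M [ [ t ] ⟩ → • t ≤ᵐ M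
  enabled (_ , M[t⟩) = proj₁ (fired M[t⟩)

  -- Firing a step amounts to firing its transitions one after the other.
  reachable-invariant : (P : Marking → Set) →
    (∀ {M M′} → M ≗ M′ → P M → P M′) →
    (∀ {M} t → • t ≤ᵐ M → P M → P ((M -ᵐ • t) +ᵐ t •)) →
    P M₀ → ∀ {M} → Reachable M → P M
  reachable-invariant P resp one P₀ = go
    where
    sequence : ∀ G {M} → pre G ≤ᵐ M → P M → P ((M -ᵐ pre G) +ᵐ post G)
    sequence [] _ PM = resp (λ s → sym (+-identityʳ _)) PM
    sequence (t ∷ G) {M} le PM =
      resp (λ s → rearrange (M s) ((• t) s) ((t •) s) (pre G s) (post G s) (rest≤ s))
        (sequence G (λ s → ≤-trans (rest≤ s) (m≤m+n _ _))
          (one t (λ s → ≤-trans (m≤m+n _ _) (le s)) PM))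
      where
      rest≤ : ∀ s → pre G s ≤ M s ∸ (• t) s
      rest≤ s = m+n≤o⇒m≤o∸n (pre G s) (subst (_≤ M s) (+-comm ((• t) s) _) (le s))
      rearrange : ∀ m a b c d → c ≤ m ∸ a → ((m ∸ a) + b ∸ c) + d ≡ (m ∸ (a + c)) + (b + d)
      rearrange m a b c d le = begin
        ((m ∸ a) + b ∸ c) + d    ≡⟨ cong (_+ d) (+-∸-comm b le) ⟩
        ((m ∸ a ∸ c) + b) + d    ≡⟨ +-assoc (m ∸ a ∸ c) b d ⟩
        (m ∸ a ∸ c) + (b + d)    ≡⟨ cong (_+ (b + d)) (∸-+-assoc m a c) ⟩
        (m ∸ (a + c)) + (b + d)  ∎
        where open ≡-Reasoning
    go : ∀ {M} → Reachable M → P M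
    go initial = P₀
    go (step {G = G} r (_ , le , eq)) = resp (λ s → sym (eq s)) (sequence G le (go r))

-- Conflict classes along a run and their names

module Conflict (em : ExcludedMiddle 0ℓ) {Act : Set} (N : PetriNet Act)
  (finitary : Finitary N) (structural : StructuralConflict N)
  (noM : ¬ HasFullyReachablePureM N) where

  open PetriNet N
  open Classical em
  open NetLemmas N

  infix 4 _#_

  _#_ : T → T → Set
  t # u = ¬ ((• t ∩ • u) ≗ ∅)

  ⊓-integral : ∀ m n → m ⊓ n ≡ 0 → m ≢ 0 → n ≡ 0
  ⊓-integral zero    n       _ m≢0 = ⊥-elim (m≢0 refl)
  ⊓-integral (suc m) zero    _ _   = refl

  ¬#-disjoint : ∀ {t u} → ¬ t # u → ∀ s → (• t) s ≢ 0 → (• u) s ≡ 0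
  ¬#-disjoint ¬t#u s = ⊓-integral _ _ (by-contradiction ¬t#u s)

  #-refl : ∀ t → t # t
  #-refl t d = proj₁ finitary t (λ s → trans (sym (⊓-idem _)) (d s))

  #-sym : ∀ {t u} → t # u → u # t
  #-sym {t} {u} t#u d = t#u (λ s → trans (⊓-comm ((• t) s) _) (d s))

  #-trans : ∀ {M t u v} → Reachable M → • t ≤ᵐ M → • u ≤ᵐ M → • v ≤ᵐ M →
    t # u → u # v → t # v
  #-trans r t≤ u≤ v≤ t#u u#v d =
    noM (_ , _ , _ , t#u , u#v , d , _ , r , λ s → ⊔-lub (⊔-lub (t≤ s) (u≤ s)) (v≤ s))

  concurrent⇒¬# : ∀ {M t u} → Reachable M → (• t +ᵐ • u) ≤ᵐ M → ¬ t # u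
  concurrent⇒¬# {M} {t} {u} r le t#u = t#u (structural t u
    (M , r , _ , (λ ()) ,
      (λ s → subst (_≤ M s) (cong ((• t) s +_) (sym (+-identityʳ _))) (le s)) , λ s → refl))

  step⇒¬# : ∀ {M t v G} → Reachable M → pre (t ∷ G) ≤ᵐ M → v ∈ G → ¬ v # t
  step⇒¬# {t = t} r le v∈G v#t =
    concurrent⇒¬# r (λ s → ≤-trans (+-monoʳ-≤ ((• t) s) (∈⇒•≤pre v∈G s)) (le s)) (#-sym v#t)

  pre-zero : ∀ {s} G → (∀ {v} → v ∈ G → (• v) s ≡ 0) → pre G s ≡ 0
  pre-zero []      _ = refl
  pre-zero (v ∷ G) z = cong₂ _+_ (z (here refl)) (pre-zero G (λ v∈ → z (there v∈)))

  -- At a place from which `u` consumes, no member of `G` does, so `M` has to cover `u` only;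
  -- elsewhere it has to cover `G` only.
  ¬#⇒step : ∀ {M u} G → • u ≤ᵐ M → pre G ≤ᵐ M → (∀ {v} → v ∈ G → ¬ v # u) → pre (u ∷ G) ≤ᵐ M
  ¬#⇒step {M} {u} G u≤ G≤ ¬# s with em {(• u) s ≡ 0}
  ... | yes z = subst (_≤ M s) (cong (_+ pre G s) (sym z)) (G≤ s)
  ... | no ≢0 = subst (_≤ M s)
    (sym (trans (cong ((• u) s +_)
      (pre-zero G (λ v∈ → ¬#-disjoint (λ u#v → ¬# v∈ (#-sym u#v)) s ≢0))) (+-identityʳ _)))
    (u≤ s)

  -- A history lists the transitions fired so far, the latest one first.
  marking : List T → Marking
  marking []      = M₀
  marking (t ∷ h) = (marking h -ᵐ • t) +ᵐ t •

  Enabled : List T → T → Set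
  Enabled h t = • t ≤ᵐ marking h

  data Run : List T → Set where
    []  : Run []
    _∷_ : ∀ {t h} → Enabled h t → Run h → Run (t ∷ h)

  run-reachable : ∀ {h} → Run h → Reachable (marking h)
  run-reachable []      = initial
  run-reachable (e ∷ r) = step (run-reachable r) (fireable e)

  Survives : T → List T → T → Set
  Survives t h v = Enabled h v × ¬ v # t

  survives-enabled : ∀ {t h v} → Survives t h v → Enabled (t ∷ h) v
  survives-enabled {t} {h} {v} (e , ¬v#t) s with em {(• v) s ≡ 0}
  ... | yes z = subst (_≤ marking (t ∷ h) s) (sym z) z≤n
  ... | no ≢0 = ≤-trans (e s) (subst (λ n → marking h s ≤ (marking h s ∸ n) + (t •) s)
    (sym (¬#-disjoint ¬v#t s ≢0)) (m≤m+n _ _))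

  -- The finite list given by `Finitary` depends on a reachability proof. Taking that proof from
  -- excluded middle makes the list, and with it the names of classes, a function of the history
  -- alone.
  candidates : List T → List T
  candidates h with em {Reachable (marking h)}
  ... | yes r = proj₁ (proj₂ (proj₂ finitary _ r))
  ... | no _  = []

  enabled⇒candidate : ∀ {h t} → Run h → Enabled h t → t ∈ candidates h
  enabled⇒candidate {h} run e with em {Reachable (marking h)}
  ... | yes r = proj₂ (proj₂ (proj₂ finitary _ r)) _ (_ , fireable e)
  ... | no ¬r = ⊥-elim (¬r (run-reachable run))

  representative : List T → T → T
  representative h t = first (λ v → Enabled h v × v # t) t (candidates h)

  representative-spec : ∀ {h t} → Run h → Enabled h t →
    Enabled h (representative h t) × representative h t # t
  representative-spec {h} {t} run e =
    first-satisfies (λ v → Enabled h v × v # t) (enabled⇒candidate run e) (e , #-refl _)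

  #-trans-run : ∀ {h t u v} → Run h → Enabled h t → Enabled h u → Enabled h v →
    t # u → u # v → t # v
  #-trans-run run = #-trans (run-reachable run)

  representative-cong : ∀ {h t u} → Run h → Enabled h t → Enabled h u → t # u →
    representative h t ≡ representative h u
  representative-cong run et eu t#u = first-cong _ _
    (λ v (ev , v#t) → ev , #-trans-run run ev et eu v#t t#u)
    (λ v (ev , v#u) → ev , #-trans-run run ev eu et v#u (#-sym t#u))
    (enabled⇒candidate run et) (et , #-refl _)

  -- The name of a conflict class: the length of the history at which the
  -- class came into being, and a representative of the class at that moment.
  Name : Set
  Name = ℕ × T

  -- Excluded middle picks some survivor `v`. For an enabled `w` along a run the pick does not
  -- matter: all survivors in conflict with `w` conflict with each other, so by `#⇒same-class` they
  -- had one common name.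
  class : List T → T → Name
  class []      w = 0 , representative [] w
  class (t ∷ h) w with em {∃[ v ] Survives t h v × v # w}
  ... | yes (v , _) = class h v
  ... | no _        = suc (length h) , representative (t ∷ h) w

  -- Turns the two cases of `class` into equations, which hides its appeal to excluded middle from
  -- later proofs.
  data ClassView (t : T) (h : List T) (w : T) : Set where
    old : ∀ {v} → Survives t h v → v # w → class (t ∷ h) w ≡ class h v → ClassView t h w
    new : (∀ {v} → Survives t h v → ¬ v # w) →
      class (t ∷ h) w ≡ (suc (length h) , representative (t ∷ h) w) → ClassView t h w

  class-view : ∀ t h w → ClassView t h w
  class-view t h w with em {∃[ v ] Survives t h v × v # w} in eq
  ... | yes (v , s , v#w) = old s v#w lemma
    where
    lemma : class (t ∷ h) w ≡ class h v
    lemma rewrite eq = refl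
  ... | no ¬v = new (λ s v#w → ¬v (_ , s , v#w)) lemma
    where
    lemma : class (t ∷ h) w ≡ (suc (length h) , representative (t ∷ h) w)
    lemma rewrite eq = refl

  birth≤length : ∀ h w → proj₁ (class h w) ≤ length h
  birth≤length []      w = z≤n
  birth≤length (t ∷ h) w with class-view t h w
  ... | old {v} _ _ eq rewrite eq = ≤-trans (birth≤length h v) (n≤1+n _)
  ... | new _ eq rewrite eq = ≤-refl

  new-name-fresh : ∀ {h v x} → (suc (length h) , x) ≢ class h v
  new-name-fresh {h} {v} eq =
    <⇒≱ ≤-refl (subst (_≤ length h) (sym (cong proj₁ eq)) (birth≤length h v))

  same-representative⇒# : ∀ {h t u} → Run h → Enabled h t → Enabled h u →
    representative h t ≡ representative h u → t # u
  same-representative⇒# {u = u} run et eu eq =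
    let er , r#t = representative-spec run et in
    #-trans-run run et er eu (#-sym r#t)
      (subst (_# u) (sym eq) (proj₂ (representative-spec run eu)))

  -- Induction on the run. If both transitions joined survivors, these had one name and hence
  -- conflict; they are still enabled, so transitivity in the new marking links `t` to `u`. A new
  -- name never equals an old one.
  same-class⇒# : ∀ {h t u} → Run h → Enabled h t → Enabled h u → class h t ≡ class h u → t # u
  same-class⇒# [] et eu eq = same-representative⇒# [] et eu (cong proj₂ eq)
  same-class⇒# {x ∷ h} {t} {u} run@(_ ∷ run₀) et eu eq with class-view x h t | class-view x h u
  ... | old sv v#t eqt | old sv′ v′#u equ =
    let v#v′ = same-class⇒# run₀ (proj₁ sv) (proj₁ sv′) (trans (sym eqt) (trans eq equ))
        ev   = survives-enabled {h = h} sv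
        ev′  = survives-enabled {h = h} sv′
    in #-trans-run run et ev eu (#-sym v#t) (#-trans-run run ev ev′ eu v#v′ v′#u)
  ... | old _ _ eqt | new _ equ = ⊥-elim (new-name-fresh {h} (trans (sym equ) (trans (sym eq) eqt)))
  ... | new _ eqt | old _ _ equ = ⊥-elim (new-name-fresh {h} (trans (sym eqt) (trans eq equ)))
  ... | new _ eqt | new _ equ =
    same-representative⇒# run et eu (cong proj₂ (trans (sym eqt) (trans eq equ)))

  -- This is where classes are seen not to merge. If both transitions joined survivors, transitivity
  -- in the new marking puts these in conflict, so they had one name already. If only one did, its
  -- survivor would conflict with the other transition too.
  #⇒same-class : ∀ {h t u} → Run h → Enabled h t → Enabled h u → t # u → class h t ≡ class h u
  #⇒same-class [] et eu t#u = cong (0 ,_) (representative-cong [] et eu t#u)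
  #⇒same-class {x ∷ h} {t} {u} run@(e ∷ run₀) et eu t#u with class-view x h t | class-view x h u
  ... | old sv v#t eqt | old sv′ v′#u equ =
    let ev  = survives-enabled {h = h} sv
        ev′ = survives-enabled {h = h} sv′
        v#u = #-trans-run run ev et eu v#t t#u
    in trans eqt (trans (#⇒same-class run₀ (proj₁ sv) (proj₁ sv′)
         (#-trans-run run ev eu ev′ v#u (#-sym v′#u))) (sym equ))
  ... | old sv v#t _ | new ¬v _ =
    ⊥-elim (¬v sv (#-trans-run run (survives-enabled {h = h} sv) et eu v#t t#u))
  ... | new ¬v _ | old sv v#u _ =
    ⊥-elim (¬v sv (#-trans-run run (survives-enabled {h = h} sv) eu et v#u (#-sym t#u)))
  ... | new _ eqt | new _ equ =
    trans eqt (trans (cong (suc (length h) ,_) (representative-cong run et eu t#u)) (sym equ))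

  survives-class : ∀ {t h v} → Run (t ∷ h) → Survives t h v → class (t ∷ h) v ≡ class h v
  survives-class {t} {h} {v} (_ ∷ run) sv with class-view t h v
  ... | old sv′ v′#v eq = trans eq (#⇒same-class run (proj₁ sv′) (proj₁ sv) v′#v)
  ... | new ¬v _        = ⊥-elim (¬v sv (#-refl v))

-- The implementing net

module Implementation (em : ExcludedMiddle 0ℓ) {Act : Set} (N : PetriNet Act)
  (finitary : Finitary N) (τ-free : ∀ t → PetriNet.ℓ N t ≢ τ)
  (structural : StructuralConflict N) (noM : ¬ HasFullyReachablePureM N) where

  open PetriNet N using (T; M₀; •_; _•; pre; post; Marking; ℓ)
  open Classical em
  open NetLemmas N
  open Conflict em N finitary structural noM

  -- The token on `control g` says that the controller has recorded the history `g`. A token on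
  -- `idle i` is the right of class `i` to act, spent once and for all. One on `done v` reports a
  -- termination that awaits recording.
  data Place : Set where
    control : List T → Place
    idle    : Name → Place
    offer   : Name → T → Place
    done    : T → Place

  data Transition : Set where
    fire    : Name → T → Transition
    process : List T → T → Transition

  IsClass : List T → Name → T → Set
  IsClass h i w = Enabled h w × class h w ≡ i

  consume : Place → Transition → ℕ
  consume (control g) (process h _) = ind (g ≡ h)
  consume (done v)    (process _ u) = ind (v ≡ u)
  consume (idle j)    (fire i _)    = ind (j ≡ i)
  consume (offer j v) (fire i u)    = ind (j ≡ i × v ≡ u)
  consume _           _             = 0

  -- The offers of surviving transitions are repeated: surplus offers are
  -- harmless, since a class can act only as long as it is idle.
  output : List T → Multiset Place
  output h (control g) = ind (g ≡ h)
  output h (idle i)    = ind (proj₁ i ≡ length h × ∃[ w ] IsClass h i w)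
  output h (offer i w) = ind (IsClass h i w)
  output h (done _)    = 0

  produce : Transition → Multiset Place
  produce (fire _ u) (done v) = ind (v ≡ u)
  produce (fire _ _) _        = 0
  produce (process h u)       = output (u ∷ h)

  N′ : PetriNet Act
  N′ = record
    { S = Place ; T = Transition ; Fˢᵗ = consume ; Fᵗˢ = produce ; M₀ = output []
    ; ℓ = λ { (fire _ u) → ℓ u ; (process _ _) → τ } }

  module N′ = PetriNet N′
  module N′L = NetLemmas N′

  -- Distributedness of the implementation

  ind-refl≤ : ∀ {X : Set} (x : X) {n} → ind (x ≡ x) ≤ n → 1 ≤ n
  ind-refl≤ x {n} = subst (_≤ n) (ind-yes refl)

  -- The demand of a transition on a place named by its own parameter computes to `ind (x ≡ x)`, so
  -- enabledness supplies a premise of this form.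
  ind-refl≤ind : ∀ {X : Set} {x y : X} {n} → n ≡ ind (x ≡ y) → ind (x ≡ x) ≤ n → x ≡ y
  ind-refl≤ind {x = x} refl le = ind-≢0 (m<n⇒n≢0 (ind-refl≤ x le))

  -- `idle-born` carries the bound `idle≤1` through the induction: processing marks only `idle`
  -- places of names born with the extended history, and these were empty as long as the history was
  -- shorter.
  record Serial (M : N′.Marking) : Set where
    field
      history   : List T
      control≡  : ∀ g → M (control g) ≡ ind (g ≡ history)
      idle≤1    : ∀ i → M (idle i) ≤ 1
      idle-born : ∀ i → length history < proj₁ i → M (idle i) ≡ 0

  serial-step : ∀ {M} t → (N′.• t) ≤ᵐ M → Serial M → Serial ((M -ᵐ (N′.• t)) +ᵐ (t N′.•))
  serial-step {M} (fire i u) le s = record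
    { history   = history
    ; control≡  = λ g → trans (+-identityʳ _) (control≡ g)
    ; idle≤1    = λ j → ≤-trans (idle≤ j) (idle≤1 j)
    ; idle-born = λ j lt → n≤0⇒n≡0 (≤-trans (idle≤ j) (≤-reflexive (idle-born j lt)))
    }
    where
    open Serial s
    idle≤ : ∀ j → (M (idle j) ∸ ind (j ≡ i)) + 0 ≤ M (idle j)
    idle≤ j = ≤-trans (≤-reflexive (+-identityʳ _)) (m∸n≤m (M (idle j)) (ind (j ≡ i)))
  serial-step {M} (process g u) le s = record
    { history   = u ∷ g
    ; control≡  = λ g′ → cong (_+ ind (g′ ≡ u ∷ g))
        (trans (cong (_∸ ind (g′ ≡ g)) (trans (control≡ g′) (cong (λ h → ind (g′ ≡ h)) (sym g≡))))
               (n∸n≡0 (ind (g′ ≡ g))))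
    ; idle≤1    = idle≤1′
    ; idle-born = λ j lt → cong₂ _+_
        (idle-born j (subst (λ h → length h < proj₁ j) g≡ (<-trans (n<1+n _) lt)))
        (ind-no (λ born → <-irrefl (sym (proj₁ born)) lt))
    }
    where
    open Serial s
    g≡ : g ≡ history
    g≡ = ind-refl≤ind (control≡ g) (le (control g))
    idle≤1′ : ∀ j → M (idle j) + output (u ∷ g) (idle j) ≤ 1
    idle≤1′ j with em {proj₁ j ≡ suc (length g)}
    ... | yes born = subst (λ n → n + output (u ∷ g) (idle j) ≤ 1)
      (sym (idle-born j (≤-reflexive (trans (cong (λ h → suc (length h)) (sym g≡)) (sym born)))))
      ind-≤1
    ... | no ¬born = subst (_≤ 1)
      (sym (trans (cong (M (idle j) +_) (ind-no (λ b → ¬born (proj₁ b)))) (+-identityʳ _)))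
      (idle≤1 j)

  reachable⇒serial : ∀ {M} → N′.Reachable M → Serial M
  reachable⇒serial = N′L.reachable-invariant Serial
    (λ eq s → let open Serial s in record
      { history   = history
      ; control≡  = λ g → trans (sym (eq (control g))) (control≡ g)
      ; idle≤1    = λ i → subst (_≤ 1) (eq (idle i)) (idle≤1 i)
      ; idle-born = λ i lt → trans (sym (eq (idle i))) (idle-born i lt) })
    serial-step
    (record
      { history   = []
      ; control≡  = λ g → refl
      ; idle≤1    = λ i → ind-≤1
      ; idle-born = λ i lt → ind-no (λ born → <-irrefl (sym (proj₁ born)) lt) })

  Location : Set
  Location = ⊤ ⊎ Name

  -- The `done` places belong to the controller although every class fills them: only the preplaces
  -- of a transition must share its location.
  location : Place ⊎ Transition → Location
  location (inj₁ (control _))   = inj₁ tt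
  location (inj₁ (idle i))      = inj₂ i
  location (inj₁ (offer i _))   = inj₂ i
  location (inj₁ (done _))      = inj₁ tt
  location (inj₂ (fire i _))    = inj₂ i
  location (inj₂ (process _ _)) = inj₁ tt

  preplace-location : ∀ s t → s ∈ᵐ (N′.• t) → location (inj₂ t) ≡ location (inj₁ s)
  preplace-location (control _) (fire _ _)    s∈ = ⊥-elim (s∈ refl)
  preplace-location (control _) (process _ _) s∈ = refl
  preplace-location (idle j)    (fire _ _)    s∈ = cong inj₂ (sym (ind-≢0 s∈))
  preplace-location (idle _)    (process _ _) s∈ = ⊥-elim (s∈ refl)
  preplace-location (offer _ _) (fire _ _)    s∈ = cong inj₂ (sym (proj₁ (ind-≢0 s∈)))
  preplace-location (offer _ _) (process _ _) s∈ = ⊥-elim (s∈ refl)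
  preplace-location (done _)    (fire _ _)    s∈ = ⊥-elim (s∈ refl)
  preplace-location (done _)    (process _ _) s∈ = refl

  -- Two transitions at one location would both take a token from the same `idle` or `control`
  -- place, which holds at most one.
  concurrent-location : ∀ t u → t N′.⌣ u → location (inj₂ t) ≢ location (inj₂ u)
  concurrent-location (fire i _) (fire .i _) (M , r , _ , _ , le , _) refl =
    <⇒≱ (subst (_≤ M (idle i)) (cong₂ (λ m n → m + (n + 0)) (ind-yes refl) (ind-yes refl)) (le (idle i)))
        (Serial.idle≤1 (reachable⇒serial r) i)
  concurrent-location (process g _) (process g′ _) (M , r , _ , _ , le , _) _ =
    <⇒≱ (subst (_≤ M (control g)) (cong₂ (λ m n → m + (n + 0)) (ind-yes refl) (ind-yes (trans g≡ (sym g′≡))))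
          (le (control g)))
        (≤-trans (≤-reflexive (control≡ g)) ind-≤1)
    where
    open Serial (reachable⇒serial r)
    g≡ : g ≡ history
    g≡ = ind-refl≤ind (control≡ g) (≤-trans (m≤m+n _ _) (le (control g)))
    g′≡ : g′ ≡ history
    g′≡ = ind-refl≤ind (control≡ g′)
      (≤-trans (≤-trans (m≤m+n _ 0) (m≤n+m _ (ind (g′ ≡ g)))) (le (control g′)))

  distributed : Distributed N′
  distributed = Location , location , preplace-location , concurrent-location

  -- The invariant relating the two nets

  Live : List T → List T → Name → Set
  -- `G` will be the list of transitions begun but not yet processed: a class is live until one of
  -- its members begins.
  Live h G i = (∃[ u ] IsClass h i u) × (∀ {v} → v ∈ G → class h v ≢ i)

  -- The implementation has processed the history h; the transitions in C
  -- have terminated but are not yet processed, those in U are still running.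
  record Invariant (h C : List T) (M′ : N′.Marking) (M : Marking) (U : List T) : Set where
    field
      run            : Run h
      step≤          : pre (U ++ C) ≤ᵐ marking h
      marking≡       : M ≗ (marking h -ᵐ pre (U ++ C)) +ᵐ post C
      control≡       : ∀ g → M′ (control g) ≡ ind (g ≡ h)
      done≡          : ∀ v → M′ (done v) ≡ count C v
      idle≡          : ∀ i → M′ (idle i) ≡ ind (Live h (U ++ C) i)
      -- Offers of classes that have acted may linger, so soundness is claimed only for live names
      -- and for names yet to be born; for the latter it says that the place is empty.
      offer-sound    : ∀ {i w} → Live h (U ++ C) i ⊎ length h < proj₁ i →
                         M′ (offer i w) ≢ 0 → IsClass h i w
      offer-complete : ∀ {i w} → Live h (U ++ C) i → IsClass h i w → M′ (offer i w) ≢ 0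

    member-enabled : ∀ {v} → v ∈ U ++ C → Enabled h v
    member-enabled v∈ s = ≤-trans (∈⇒•≤pre v∈ s) (step≤ s)

  start : List T → T → Transition
  start h u = fire (class h u) u

  initial-invariant : Invariant [] [] (output []) M₀ []
  initial-invariant = record
    { run            = []
    ; step≤          = λ s → z≤n
    ; marking≡       = λ s → sym (+-identityʳ _)
    ; control≡       = λ g → refl
    ; done≡          = λ v → refl
    ; idle≡          = λ i → ind-cong (λ born → proj₂ born , λ ())
        (λ ((w , e , eq) , _) → sym (cong proj₁ eq) , w , e , eq)
    ; offer-sound    = λ _ → ind-≢0
    ; offer-complete = λ _ w → λ eq → 1+n≢0 (trans (sym (ind-yes w)) eq)
    }

  module _ {h C M′ M U} (inv : Invariant h C M′ M U) where
    open Invariant inv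

    -- The begun transitions lie in other classes, so none conflicts with `u`. For the converse
    -- `step⇒live`, concurrent transitions never conflict and so never share a class.
    live⇒step : ∀ {u} → Enabled h u → Live h (U ++ C) (class h u) → pre (u ∷ U ++ C) ≤ᵐ marking h
    live⇒step e live = ¬#⇒step (U ++ C) e step≤
      (λ v∈ v#u → proj₂ live v∈ (#⇒same-class run (member-enabled v∈) e v#u))

    step⇒live : ∀ {u} → pre (u ∷ U ++ C) ≤ᵐ marking h → Live h (U ++ C) (class h u)
    step⇒live {u} le = (u , e , refl) , λ v∈ eq →
      step⇒¬# (run-reachable run) le v∈ (same-class⇒# run (member-enabled v∈) e eq)
      where
      e : Enabled h u
      e s = ≤-trans (m≤m+n _ _) (le s)

    step⇒residual : ∀ {u} → pre (u ∷ U ++ C) ≤ᵐ marking h → • u ≤ᵐ (marking h -ᵐ pre (U ++ C))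
    step⇒residual {u} le s = m+n≤o⇒m≤o∸n ((• u) s) (le s)

    step⇒enabled : ∀ {u} → pre (u ∷ U ++ C) ≤ᵐ marking h → • u ≤ᵐ M
    step⇒enabled {u} le s = subst ((• u) s ≤_) (sym (marking≡ s))
      (≤-trans (step⇒residual le s) (m≤m+n _ _))

    idle⇒live : ∀ {i} → 1 ≤ M′ (idle i) → Live h (U ++ C) i
    idle⇒live {i} le = ind-≢0 (λ z → m<n⇒n≢0 le (trans (idle≡ i) z))

    start-invariant : ∀ {u M₁′ M₁} → pre (u ∷ U ++ C) ≤ᵐ marking h →
      M₁′ ≗ M′ -ᵐ N′.• (start h u) → M₁ ≗ M -ᵐ • u → Invariant h C M₁′ M₁ (U ∷ʳ u)
    start-invariant {u} {M₁′} {M₁} le eq′ eq = record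
      { run            = run
      ; step≤          = λ s → subst (_≤ marking h s) (sym (pre-↭ perm s)) (le s)
      ; marking≡       = marking₁
      ; control≡       = λ g → trans (eq′ _) (control≡ g)
      ; done≡          = λ v → trans (eq′ _) (done≡ v)
      ; idle≡          = idle₁
      ; offer-sound    = λ {j} {w} live ≢0 → offer-sound (weaken live)
          (λ z → ≢0 (trans (eq′ _) (trans (cong (_∸ consume (offer j w) (start h u)) z)
            (0∸n≡0 (consume (offer j w) (start h u))))))
      -- The consumed offer belongs to the class of `u`, which ceases to be live; the offers of live
      -- classes are intact.
      ; offer-complete = λ {j} {w} live w-class z →
          offer-complete (live-weaken live) w-class
            (trans (cong (M′ (offer j w) ∸_) (sym (ind-no (λ both → live≢ live (proj₁ both)))))
                   (trans (sym (eq′ _)) z))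
      }
      where
      perm : (U ∷ʳ u) ++ C ↭ u ∷ U ++ C
      perm = ↭-trans (↭-reflexive (++-assoc U [ u ] C)) (shift u U C)
      live-weaken : ∀ {j} → Live h ((U ∷ʳ u) ++ C) j → Live h (U ++ C) j
      live-weaken (w , avoid) = w , λ v∈ → avoid (∈-resp-↭ (↭-sym perm) (there v∈))
      weaken : ∀ {j} → Live h ((U ∷ʳ u) ++ C) j ⊎ length h < proj₁ j →
               Live h (U ++ C) j ⊎ length h < proj₁ j
      weaken (inj₁ live) = inj₁ (live-weaken live)
      weaken (inj₂ lt)   = inj₂ lt
      live≢ : ∀ {j} → Live h ((U ∷ʳ u) ++ C) j → j ≢ class h u
      live≢ (_ , avoid) refl = avoid (∈-resp-↭ (↭-sym perm) (here refl)) refl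
      marking₁ : M₁ ≗ (marking h -ᵐ pre ((U ∷ʳ u) ++ C)) +ᵐ post C
      marking₁ s = begin
        M₁ s                                ≡⟨ eq s ⟩
        M s ∸ d                             ≡⟨ cong (_∸ d) (marking≡ s) ⟩
        (a ∸ b) + c ∸ d                     ≡⟨ +-∸-comm c (step⇒residual le s) ⟩
        (a ∸ b ∸ d) + c                     ≡⟨ cong (_+ c) (∸-+-assoc a b d) ⟩
        (a ∸ (b + d)) + c                   ≡⟨ cong (λ n → (a ∸ n) + c) (+-comm b d) ⟩
        (a ∸ (d + b)) + c                   ≡⟨ cong (λ n → (a ∸ n) + c) (pre-↭ perm s) ⟨
        (a ∸ pre ((U ∷ʳ u) ++ C) s) + c     ∎
        where
        open ≡-Reasoning
        a b c d : ℕ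
        a = marking h s
        b = pre (U ++ C) s
        c = post C s
        d = (• u) s
      idle₁ : ∀ j → M₁′ (idle j) ≡ ind (Live h ((U ∷ʳ u) ++ C) j)
      idle₁ j with em {j ≡ class h u}
      ... | yes j≡ = trans (eq′ _) (trans (m≤n⇒m∸n≡0 {M′ (idle j)} (≤-trans (≤-reflexive (idle≡ j))
              (≤-trans ind-≤1 (≤-reflexive (sym (ind-yes j≡))))))
            (sym (ind-no (λ live → live≢ live j≡))))
      ... | no j≢ = trans (eq′ _) (trans (cong (M′ (idle j) ∸_) (ind-no j≢)) (trans (idle≡ j)
            (ind-cong strengthen live-weaken)))
        where
        strengthen : Live h (U ++ C) j → Live h ((U ∷ʳ u) ++ C) j
        strengthen (w , avoid) = w , λ v∈ → avoid′ (∈-resp-↭ perm v∈)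
          where
          avoid′ : ∀ {v} → v ∈ u ∷ U ++ C → class h v ≢ j
          avoid′ (here refl) eq = j≢ (sym eq)
          avoid′ (there v∈)     = avoid v∈

    -- Termination moves a transition from `U` to `C`, which only permutes `U ++ C`, so no class
    -- changes its liveness.
    finish-invariant : ∀ {M₁′ M₁} k → M₁′ ≗ M′ +ᵐ (start h (lookup U k) N′.•) →
      M₁ ≗ M +ᵐ (lookup U k •) → Invariant h (lookup U k ∷ C) M₁′ M₁ (removeAt U k)
    finish-invariant {M₁′} {M₁} k eq′ eq = record
      { run            = run
      ; step≤          = λ s → subst (_≤ marking h s) (sym (pre-↭ perm s)) (step≤ s)
      ; marking≡       = λ s → trans (eq s) (trans (cong (_+ (u •) s) (marking≡ s)) (trans
          (+-assoc (marking h s ∸ pre (U ++ C) s) (post C s) ((u •) s))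
          (cong₂ _+_ (cong (marking h s ∸_) (sym (pre-↭ perm s))) (+-comm (post C s) ((u •) s)))))
      ; control≡       = λ g → trans (eq′ _) (trans (+-identityʳ _) (control≡ g))
      ; done≡          = λ v → trans (eq′ _) (trans (cong (_+ ind (v ≡ u)) (done≡ v)) (+-comm (count C v) _))
      ; idle≡          = λ i → trans (eq′ _) (trans (+-identityʳ _)
          (trans (idle≡ i) (ind-cong (live-resp perm) (live-resp (↭-sym perm)))))
      ; offer-sound    = λ { (inj₁ live) ≢0 → offer-sound (inj₁ (live-resp (↭-sym perm) live)) (unchanged ≢0)
                           ; (inj₂ lt) ≢0 → offer-sound (inj₂ lt) (unchanged ≢0) }
      ; offer-complete = λ live w z → offer-complete (live-resp (↭-sym perm) live) w
          (trans (sym (+-identityʳ _)) (trans (sym (eq′ _)) z))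
      }
      where
      u : T
      u = lookup U k
      perm : removeAt U k ++ (u ∷ C) ↭ U ++ C
      perm = ↭-trans (shift u (removeAt U k) C) (++⁺ʳ C (lookup-removeAt-↭ U k))
      live-resp : ∀ {G H i} → G ↭ H → Live h H i → Live h G i
      live-resp p (w , avoid) = w , λ v∈ → avoid (∈-resp-↭ p v∈)
      unchanged : ∀ {i w} → M₁′ (offer i w) ≢ 0 → M′ (offer i w) ≢ 0
      unchanged ≢0 z = ≢0 (trans (eq′ _) (trans (+-identityʳ _) z))

    module _ {u C₀} (C↭ : C ↭ u ∷ C₀) where
      private
        perm : U ++ C ↭ u ∷ U ++ C₀
        perm = ↭-trans (++⁺ˡ U C↭) (shift u U C₀)

        step≤′ : pre (u ∷ U ++ C₀) ≤ᵐ marking h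
        step≤′ s = subst (_≤ marking h s) (pre-↭ perm s) (step≤ s)

        u-enabled : Enabled h u
        u-enabled = member-enabled (∈-resp-↭ (↭-sym perm) (here refl))

        run′ : Run (u ∷ h)
        run′ = u-enabled ∷ run

      member-survives : ∀ {v} → v ∈ U ++ C₀ → Survives u h v
      member-survives v∈ = member-enabled (∈-resp-↭ (↭-sym perm) (there v∈)) ,
        step⇒¬# (run-reachable run) step≤′ v∈

      -- Running transitions are concurrent with the processed `u`, so they survive it and keep the
      -- names of their classes.
      start-stable : map (start h) U ≡ map (start (u ∷ h)) U
      start-stable = map-cong-local (tabulate λ {v} v∈ →
        cong (λ i → fire i v) (sym (survives-class run′ (member-survives (∈-++⁺ˡ v∈)))))

      private
        avoid⇒class : ∀ {i w} → class h u ≢ i → IsClass h i w → IsClass (u ∷ h) i w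
        avoid⇒class {w = w} u≢ (e , eq) =
          survives-enabled {h = h} sv , trans (survives-class run′ sv) eq
          where
          sv : Survives u h w
          sv = e , λ w#u → u≢ (trans (sym (#⇒same-class run e u-enabled w#u)) eq)

        live-forward : ∀ {i} → Live h (U ++ C) i → Live (u ∷ h) (U ++ C₀) i
        live-forward ((w , w-class) , avoid) =
          (w , avoid⇒class (avoid (∈-resp-↭ (↭-sym perm) (here refl))) w-class) ,
          λ v∈ eq → avoid (∈-resp-↭ (↭-sym perm) (there v∈))
            (trans (sym (survives-class run′ (member-survives v∈))) eq)

        -- A name that is not newborn was inherited from some `x` that survives `u`; as `x` is not
        -- in conflict with `u`, the class does not contain `u`.
        live-backward : ∀ {i} → proj₁ i ≢ suc (length h) → Live (u ∷ h) (U ++ C₀) i → Live h (U ++ C) i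
        live-backward ¬born ((w , e , eq) , avoid) with class-view u h w
        ... | new _ eq₁ = ⊥-elim (¬born (cong proj₁ (trans (sym eq) eq₁)))
        ... | old {x} (ex , ¬x#u) _ eq₁ =
          (x , ex , trans (sym eq₁) eq) , λ v∈ → avoid′ (∈-resp-↭ perm v∈)
          where
          avoid′ : ∀ {v} → v ∈ u ∷ U ++ C₀ → class h v ≢ _
          avoid′ (here refl) eq₂ = ¬x#u (same-class⇒# run ex u-enabled (trans (sym eq₁) (trans eq (sym eq₂))))
          avoid′ (there v∈) eq₂ = avoid v∈ (trans (survives-class run′ (member-survives v∈)) eq₂)

      -- The effect of `u` moves from `pre (U ++ C)` and `post C` into `marking (u ∷ h)`, so `M`
      -- stays the same.
      process-invariant : ∀ {M₁′} →
        M₁′ ≗ (M′ -ᵐ N′.• (process h u)) +ᵐ (process h u N′.•) → Invariant (u ∷ h) C₀ M₁′ M U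
      process-invariant {M₁′} eq′ = record
        { run            = run′
        ; step≤          = λ s → ≤-trans (rest≤ s) (m≤m+n _ _)
        ; marking≡       = marking₁
        ; control≡       = λ g → trans (eq′ _) (cong (_+ ind (g ≡ u ∷ h))
            (trans (cong (_∸ ind (g ≡ h)) (control≡ g)) (n∸n≡0 (ind (g ≡ h)))))
        ; done≡          = λ v → trans (eq′ _) (trans (+-identityʳ _) (trans
            (cong (_∸ ind (v ≡ u)) (trans (done≡ v) (count-↭ C↭ v))) (m+n∸m≡n (ind (v ≡ u)) _)))
        ; idle≡          = idle₁
        ; offer-sound    = offer-sound₁
        -- The new output offers all members of all current classes afresh.
        ; offer-complete = λ {i} {w} _ w-class z → 1+n≢0 (trans (sym (ind-yes w-class))
            (m+n≡0⇒n≡0 (M′ (offer i w)) (trans (sym (eq′ _)) z)))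
        }
        where
        rest≤ : ∀ s → pre (U ++ C₀) s ≤ marking h s ∸ (• u) s
        rest≤ s = m+n≤o⇒m≤o∸n (pre (U ++ C₀) s)
          (subst (_≤ marking h s) (+-comm ((• u) s) _) (step≤′ s))
        marking₁ : M ≗ (marking (u ∷ h) -ᵐ pre (U ++ C₀)) +ᵐ post C₀
        marking₁ s = begin
          M s                                    ≡⟨ marking≡ s ⟩
          (a ∸ pre (U ++ C) s) + post C s        ≡⟨ cong₂ (λ m n → (a ∸ m) + n) (pre-↭ perm s) (post-↭ C↭ s) ⟩
          (a ∸ (b + d)) + (c + e)                ≡⟨ cong (_+ (c + e)) (∸-+-assoc a b d) ⟨
          (a ∸ b ∸ d) + (c + e)                  ≡⟨ +-assoc (a ∸ b ∸ d) c e ⟨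
          (a ∸ b ∸ d) + c + e                    ≡⟨ cong (_+ e) (+-∸-comm c (rest≤ s)) ⟨
          ((a ∸ b) + c ∸ d) + e                  ∎
          where
          open ≡-Reasoning
          a b c d e : ℕ
          a = marking h s
          b = (• u) s
          c = (u •) s
          d = pre (U ++ C₀) s
          e = post C₀ s
        idle₁ : ∀ i → M₁′ (idle i) ≡ ind (Live (u ∷ h) (U ++ C₀) i)
        idle₁ i with em {proj₁ i ≡ suc (length h)}
        -- A newborn name is fresh: its place was empty, and the begun transitions keep names given
        -- earlier.
        ... | yes born = trans (eq′ _) (trans
          (cong (_+ output (u ∷ h) (idle i)) (trans (idle≡ i) (ind-no λ ((w , _ , eq) , _) →
            new-name-fresh {h} (trans (cong (_, proj₂ i) (sym born)) (sym eq)))))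
          (ind-cong
            (λ (_ , w) → w , λ {v} v∈ eq → new-name-fresh {h} {v}
              (trans (cong (_, proj₂ i) (sym born))
                (trans (sym eq) (survives-class run′ (member-survives v∈)))))
            (λ (w , _) → born , w)))
        ... | no ¬born = trans (eq′ _) (trans
          (cong (M′ (idle i) +_) (ind-no (λ b → ¬born (proj₁ b))))
          (trans (+-identityʳ _) (trans (idle≡ i) (ind-cong live-forward (live-backward ¬born)))))
        -- Newborn names and names still to come were equally unborn before this step.
        earlier : ∀ {i} → Live (u ∷ h) (U ++ C₀) i ⊎ suc (length h) < proj₁ i →
          Live h (U ++ C) i ⊎ length h < proj₁ i
        earlier {i} (inj₁ live) with em {proj₁ i ≡ suc (length h)}
        ... | yes born = inj₂ (≤-reflexive (sym born))
        ... | no ¬born = inj₁ (live-backward ¬born live)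
        earlier (inj₂ lt) = inj₂ (<-trans (n<1+n _) lt)
        earlier⇒avoid : ∀ {i} → Live h (U ++ C) i ⊎ length h < proj₁ i → class h u ≢ i
        earlier⇒avoid (inj₁ (_ , avoid)) = avoid (∈-resp-↭ (↭-sym perm) (here refl))
        earlier⇒avoid (inj₂ lt) refl = <⇒≱ lt (birth≤length h u)
        offer-sound₁ : ∀ {i w} → Live (u ∷ h) (U ++ C₀) i ⊎ suc (length h) < proj₁ i →
          M₁′ (offer i w) ≢ 0 → IsClass (u ∷ h) i w
        offer-sound₁ {i} {w} l ≢0 with em {M′ (offer i w) ≡ 0}
        ... | yes z = ind-≢0 (λ z₁ → ≢0 (trans (eq′ _) (cong₂ _+_ z z₁)))
        ... | no M′≢0 = avoid⇒class (earlier⇒avoid (earlier l)) (offer-sound (earlier l) M′≢0)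

      process-enabled : (N′.• (process h u)) ≤ᵐ M′
      process-enabled (control g) = ≤-reflexive (sym (control≡ g))
      process-enabled (done v)    = subst (ind (v ≡ u) ≤_) (sym (trans (done≡ v) (count-↭ C↭ v))) (m≤m+n _ _)
      process-enabled (idle _)    = z≤n
      process-enabled (offer _ _) = z≤n

    start-enabled : ∀ {u} → Enabled h u → Live h (U ++ C) (class h u) → (N′.• (start h u)) ≤ᵐ M′
    start-enabled {u} e live (idle j) with em {j ≡ class h u}
    ... | yes refl = ≤-reflexive (sym (trans (idle≡ j) (ind-yes live)))
    ... | no _     = z≤n
    start-enabled {u} e live (offer j w) with em {j ≡ class h u × w ≡ u}
    ... | yes (refl , refl) = n≢0⇒n>0 (offer-complete live (e , refl))
    ... | no _              = z≤n
    start-enabled _ _ (control _) = z≤n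
    start-enabled _ _ (done _)    = z≤n

    -- The token on `idle i` shows that the class is live, which makes the offer of `u` trustworthy.
    fire-enabled : ∀ {i u} → (N′.• (fire i u)) ≤ᵐ M′ → pre (u ∷ U ++ C) ≤ᵐ marking h × class h u ≡ i
    fire-enabled {i} {u} le with idle⇒live (ind-refl≤ i (le (idle i)))
    ... | live with offer-sound {i} {u} (inj₁ live)
          (m<n⇒n≢0 (subst (_≤ M′ (offer i u)) (ind-yes (refl , refl)) (le (offer i u))))
    ...   | e , refl = live⇒step e live , refl

  -- Branching bisimulation and divergence

  module I = LTS (ST-LTS N′)

  Related : STMarking N′ → STMarking N → Set
  Related (M′ , U′) (M , U) = ∃[ h ] ∃[ C ] Invariant h C M′ M U × U′ ≡ map (start h) U

  -- The control token identifies the history of the silent step, and the `done` token puts `u`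
  -- among `C`.
  τ-processes : ∀ {h C M′ M U U′ p} → Invariant h C M′ M U → I.Trans (M′ , U′) τ p →
    ∃[ u ] ∃[ C₀ ] C ↭ u ∷ C₀ × Invariant (u ∷ h) C₀ (proj₁ p) M U
      × map (start h) U ≡ map (start (u ∷ h)) U × proj₂ p ≡ U′
  τ-processes inv ((fire _ u , u-silent , _) , _) = ⊥-elim (τ-free u u-silent)
  τ-processes {C = C} inv ((process g u , _ , M′[t⟩) , U≡) with N′L.fired M′[t⟩
  ... | le , eq with ind-refl≤ind (Invariant.control≡ inv g) (le (control g))
                   | ∈⇒↭ (count-∈ C (m<n⇒n≢0 (subst (1 ≤_) (Invariant.done≡ inv u)
                       (ind-refl≤ u (le (done u))))))
  ...   | refl | C₀ , C↭ =
    u , C₀ , C↭ , process-invariant inv C↭ eq , start-stable inv C↭ , U≡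

  no-divergence : ∀ {h M U} C (π : ℕ → I.State) → Invariant h C (proj₁ (π 0)) M U →
    ¬ (∀ k → I.Trans (π k) τ (π (suc k)))
  no-divergence C = go (length C) C ≤-refl
    where
    -- `n` bounds the length of `C`, from which every τ-step removes an element.
    go : ∀ n {h M U} C → length C ≤ n → (π : ℕ → I.State) → Invariant h C (proj₁ (π 0)) M U →
      ¬ (∀ k → I.Trans (π k) τ (π (suc k)))
    go n C C≤n π inv path with τ-processes inv (path 0)
    ... | u , C₀ , C↭ , inv₁ , _ with n | subst (_≤ n) (↭-length C↭) C≤n
    ...   | suc m | s≤s C₀≤m = go m C₀ C₀≤m (λ k → π (suc k)) inv₁ (λ k → path (suc k))

  -- Lets the implementation catch up before it has to match a start in `N`; `M` and `U` do not
  -- change meanwhile.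
  drain : ∀ {h M′ M U} C → Invariant h C M′ M U → ∃[ h₁ ] ∃[ M₁′ ]
    ((M′ , map (start h) U) I.⟹ (M₁′ , map (start h₁) U)) × Invariant h₁ [] M₁′ M U
  drain [] inv = _ , _ , ε , inv
  drain {h} {M′} (u ∷ C) inv with drain C (process-invariant inv ↭-refl (λ _ → refl))
  ... | h₁ , M₁′ , path , inv₁ = h₁ , M₁′ ,
    ((process h u , refl , N′L.fireable (process-enabled inv ↭-refl)) ,
      sym (start-stable inv ↭-refl)) ◅ path , inv₁

  forward : BranchingTransfer (ST-LTS N′) (ST-LTS N) Related
  forward {α = vis (a ⁺)} (h , C , inv , refl) (process _ _ , () , _)
  forward {M′ , _} {M , U} {vis (a ⁺)} (h , C , inv , refl) (fire i u , u↦a , M′[t⟩ , eq′ , refl)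
    with fire-enabled inv (N′L.enabled M′[t⟩)
  ... | le , refl =
    (M , U) , (M -ᵐ • u , U ∷ʳ u) , ε ,
    inj₁ (u , u↦a , (_ , fireable (step⇒enabled inv le)) , (λ _ → refl) , refl) ,
    (h , C , inv , refl) ,
    (h , C , start-invariant inv le eq′ (λ _ → refl) , sym (map-++ (start h) U [ u ]))
  forward {M′ , _} {M , U} {vis (a ⁻ n)} (h , C , inv , refl) (i , n≡ , i↦a , refl , eq′)
    with unmap-index (start h) U i
  ... | k , i≡k , lookup≡ , rest≡ =
    (M , U) , (M +ᵐ lookup U k • , removeAt U k) , ε ,
    inj₁ (k , trans n≡ (cong suc i≡k) , trans (cong N′.ℓ (sym lookup≡)) i↦a , refl , λ _ → refl) ,
    (h , C , inv , refl) ,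
    (h , _ , finish-invariant inv k
      (λ s → trans (eq′ s) (cong (λ t → M′ s + (t N′.•) s) lookup≡)) (λ _ → refl) , rest≡)
  forward {q = q} {τ} (h , C , inv , refl) tr with τ-processes inv tr
  ... | u , C₀ , C↭ , inv₁ , stable , U≡ =
    q , q , ε , inj₂ (refl , refl) , (h , C , inv , refl) , (u ∷ h , C₀ , inv₁ , trans U≡ stable)

  backward : BranchingTransfer (ST-LTS N) (ST-LTS N′) (λ q p → Related p q)
  backward {M , U} {M′ , _} {vis (a ⁺)} (h , C , inv , refl) (u , u↦a , M[u⟩ , eq , refl)
    with drain C inv
  ... | h₁ , M₁′ , path , inv₁ =
    _ , (M₁′ -ᵐ N′.• (start h₁ u) , map (start h₁) U ∷ʳ start h₁ u) , path ,
    inj₁ (start h₁ u , u↦a ,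
      (_ , N′L.fireable (start-enabled inv₁ (proj₁ (proj₂ (proj₁ live))) live)) , (λ _ → refl) , refl) ,
    (h₁ , [] , inv₁ , refl) ,
    (h₁ , [] , start-invariant inv₁ le (λ _ → refl) eq , sym (map-++ (start h₁) U [ u ]))
    where
    open Invariant inv₁
    -- With nothing left to process, `M` is what the running transitions leave of `marking h₁`, so
    -- `u` is concurrent with them.
    le : pre (u ∷ U ++ []) ≤ᵐ marking h₁
    le s = m≤o∸n⇒m+n≤o ((• u) s) (step≤ s)
      (subst ((• u) s ≤_) (trans (marking≡ s) (+-identityʳ _)) (enabled M[u⟩ s))
    live = step⇒live inv₁ le
  backward {M , U} {M′ , _} {vis (a ⁻ n)} (h , C , inv , refl) (k , n≡ , k↦a , refl , eq)
    with map-index (start h) U k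
  ... | i , i≡k , lookup≡ , rest≡ =
    (M′ , map (start h) U) , (M′ +ᵐ lookup (map (start h) U) i N′.• , removeAt (map (start h) U) i) , ε ,
    inj₁ (i , trans n≡ (cong suc (sym i≡k)) , trans (cong N′.ℓ lookup≡) k↦a , refl , λ _ → refl) ,
    (h , C , inv , refl) ,
    (h , _ , finish-invariant inv k
      (λ s → cong (λ t → M′ s + (t N′.•) s) lookup≡) eq , rest≡)
  backward {α = τ} _ ((u , u-silent , _) , _) = ⊥-elim (τ-free u u-silent)

  bisimilar : N′ ≈Δ-bSTb N
  bisimilar = Related
    , (([] , [] , initial-invariant , refl) , forward , backward)
    -- Both divergence conditions hold vacuously: related states of `N′` have no infinite τ-path,
    -- and `N` has no τ-steps.
    , (λ { {q = _ , _} (h , C , inv , _) π (refl , path) _ → ⊥-elim (no-divergence C π inv path) })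
    , (λ _ π (_ , path) _ → ⊥-elim (τ-free _ (proj₁ (proj₂ (proj₁ (path 0))))))

theorem7 : ExcludedMiddle 0ℓ →
    {Act : Set} (N : PetriNet Act) →
    Finitary N →
    Plain N →
    StructuralConflict N →
    ¬ HasFullyReachablePureM N →
    Σ[ N′ ∈ PetriNet Act ] (Distributed N′ × N′ ≈Δ-bSTb N)
theorem7 em N finitary plain structural noM = N′ , distributed , bisimilar
  where open Implementation em N finitary (proj₂ plain) structural noM
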